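{- Let $n \geq 1$, let $X_1, \dots, X_n$ be sets, let $q : \prod_{i=1}^n X_i \to \mathbb{R}^n$, and consider the strategic game given by the general game with outcome set $R = \mathbb{R}^n$, outcome function $q$, and selection functions $\varepsilon_i = i\text{ - }\mathrm{argmax} : (X_i \to \mathbb{R}^n) \to \mathcal{P}(X_i)$ for $1 \leq i \leq n$. Then for every strategy profile $\mathbf{x} \in \prod_{i=1}^n X_i$ the following are equivalent: (a) $\mathbf{x}$ is a Nash equilibrium in the standard sense, i.e. for all $1 \leq i \leq n$ and all $x' \in X_i$, $q(\mathbf{x})_i \geq q(\mathbf{x}[i \mapsto x'])_i$; (b) $\mathbf{x}$ is a generalised Nash equilibrium; (c) $\mathbf{x}$ is a selection equilibrium.
   Context: $X \to R$ denotes the set of all functions from $X$ to $R$, and $\mathcal{P}(X)$ the power set of $X$. A selection function is any function $\varepsilon : (X \to R) \to \mathcal{P}(X)$; for such $\varepsilon$ define $\overline{\varepsilon} : (X \to R) \to \mathcal{P}(R)$ by $\overline{\varepsilon}(p) = \{ p(x) \mid x \in \varepsilon(p) \}$. The selection function $i\text{ - }\mathrm{argmax}$ is defined, for $p : X \to \mathbb{R}^n$, by $i\text{ - }\mathrm{argmax}(p) = \{ x \in X \mid p(x)_i \geq p(x')_i \text{ for all } x' \in X \}$, where $r_i$ is the $i$th coordinate of $r \in \mathbb{R}^n$. A general $n$-player game with outcome set $R$ and strategy sets $X_i$ consists of selection functions $\varepsilon_i : (X_i \to R) \to \mathcal{P}(X_i)$, $1 \leq i \leq n$, and an outcome function $q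 : \prod_{i=1}^n X_i \to R$. For a profile $\mathbf{x}$, the unilateral context of player $i$ is $\mathcal{U}^q_i(\mathbf{x}) : X_i \to R$, $\mathcal{U}^q_i(\mathbf{x})(x) = q(\mathbf{x}[i \mapsto x])$, where $\mathbf{x}[i \mapsto x]$ is $\mathbf{x}$ with the $i$th entry replaced by $x$. A profile $\mathbf{x}$ is a generalised Nash equilibrium if $q(\mathbf{x}) \in \overline{\varepsilon_i}(\mathcal{U}^q_i(\mathbf{x}))$ for all $1 \leq i \leq n$. A profile $\mathbf{x}$ is a selection equilibrium if $x_i \in \varepsilon_i(\mathcal{U}^q_i(\mathbf{x}))$ for all $1 \leq i \leq n$. -}

module Defs where

open import Level using (Level; _⊔_; 0ℓ) renaming (suc to lsuc)
open import Data.Fin using (Fin)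
open import Data.Fin.Properties using (_≟_)
open import Data.Nat using (ℕ)
open import Data.Product using (_×_; _,_; proj₁; proj₂; ∃-syntax)
open import Data.Rational using (ℚ; _<_)
open import Data.Sum using (_⊎_; inj₁; inj₂)
open import Data.Vec.Functional.Relation.Binary.Equality.Setoid using (≋-setoid)
open import Function.Bundles using (Func; _⟨$⟩_; _⇔_; Equivalence)
open import Function.Relation.Binary.Setoid.Equality using (_⇨_)
open import Relation.Binary.Bundles using (Setoid; Poset)
open import Relation.Binary.Definitions using (_Respects_)
open import Relation.Binary.PropositionalEquality using (refl)
open import Relation.Nullary using (¬_; yes; no; contradiction)
open import Relation.Unary using (Pred; _∈_; _⊆_; _≐_; Satisfiable)
open import Relation.Unary.Properties using (≐-refl; ≐-sym; ≐-trans)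

open Setoid using (Carrier)

private
  variable
    a ℓ r s p : Level
    n : ℕ

-- Real numbers are (two-sided) Dedekind cuts of ℚ. Only the order of ℝ is
-- needed, so no arithmetic is developed.

record ℝ : Set₁ where
  field
    lower upper     : Pred ℚ 0ℓ
    lower-inhabited : Satisfiable lower
    upper-inhabited : Satisfiable upper
    lower-rounded   : ∀ t → t ∈ lower ⇔ (∃[ u ] t < u × u ∈ lower)
    upper-rounded   : ∀ t → t ∈ upper ⇔ (∃[ u ] u < t × u ∈ upper)
    disjoint        : ∀ t → ¬ (t ∈ lower × t ∈ upper)
    located         : ∀ t u → t < u → t ∈ lower ⊎ u ∈ upper

open ℝ

infix 4 _≈ᵣ_ _≤ᵣ_ _≥ᵣ_

-- Records rather than plain definitions, so that x and y can be inferred from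
-- proofs of x ≈ᵣ y and x ≤ᵣ y.

record _≈ᵣ_ (x y : ℝ) : Set where
  constructor mk≈
  field
    lower≐ : lower x ≐ lower y
    upper≐ : upper x ≐ upper y

record _≤ᵣ_ (x y : ℝ) : Set where
  constructor mk≤
  field
    lower⊆ : lower x ⊆ lower y

_≥ᵣ_ : ℝ → ℝ → Set
x ≥ᵣ y = y ≤ᵣ x

≤ᵣ⇒upper⊇ : ∀ {x y} → x ≤ᵣ y → upper y ⊆ upper x
≤ᵣ⇒upper⊇ {x} {y} (mk≤ Lx⊆Ly) {t} t∈Uy with Equivalence.to (upper-rounded y t) t∈Uy
... | u , u<t , u∈Uy with located x u t u<t
...   | inj₁ u∈Lx = contradiction (Lx⊆Ly u∈Lx , u∈Uy) (disjoint y u)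
...   | inj₂ t∈Ux = t∈Ux

ℝ-poset : Poset (lsuc 0ℓ) 0ℓ 0ℓ
ℝ-poset = record
  { Carrier = ℝ
  ; _≈_ = _≈ᵣ_
  ; _≤_ = _≤ᵣ_
  ; isPartialOrder = record
    { isPreorder = record
      { isEquivalence = record
        { refl  = mk≈ ≐-refl ≐-refl
        ; sym   = λ (mk≈ l u) → mk≈ (≐-sym l) (≐-sym u)
        ; trans = λ (mk≈ l u) (mk≈ l′ u′) → mk≈ (≐-trans l l′) (≐-trans u u′)
        }
      ; reflexive = λ (mk≈ (Lx⊆Ly , _) _) → mk≤ Lx⊆Ly
      ; trans = λ (mk≤ Lx⊆Ly) (mk≤ Ly⊆Lz) → mk≤ λ t∈Lx → Ly⊆Lz (Lx⊆Ly t∈Lx)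
      }
    ; antisym = λ { x≤y@(mk≤ Lx⊆Ly) y≤x@(mk≤ Ly⊆Lx) →
        mk≈ (Lx⊆Ly , Ly⊆Lx) (≤ᵣ⇒upper⊇ y≤x , ≤ᵣ⇒upper⊇ x≤y) }
    }
  }

ℝ^ : ℕ → Setoid (lsuc 0ℓ) 0ℓ
ℝ^ = ≋-setoid (Poset.Eq.setoid ℝ-poset)

-- ℝ carries a defined equality, so sets are setoids throughout: functions
-- preserve equality, and subsets are predicates that respect it. A bare type
-- is the special case of the setoid of its propositional equality.

record Subset (X : Setoid a ℓ) (p : Level) : Set (a ⊔ ℓ ⊔ lsuc p) where
  field
    member   : Pred (Carrier X) p
    respects : member Respects Setoid._≈_ X

open Subset public

infix 4 _∈ₛ_

_∈ₛ_ : {X : Setoid a ℓ} → Carrier X → Subset X p → Set p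
x ∈ₛ A = x ∈ member A

𝒫 : Setoid a ℓ → (p : Level) → Setoid (a ⊔ ℓ ⊔ lsuc p) (a ⊔ p)
𝒫 X p = record
  { Carrier = Subset X p
  ; _≈_ = λ A B → member A ≐ member B
  ; isEquivalence = record
    { refl  = ≐-refl
    ; sym   = ≐-sym
    ; trans = ≐-trans
    }
  }

∏ : (Fin n → Setoid a ℓ) → Setoid a ℓ
∏ X = record
  { Carrier = ∀ i → Carrier (X i)
  ; _≈_ = λ x y → ∀ i → Setoid._≈_ (X i) (x i) (y i)
  ; isEquivalence = record
    { refl  = λ i → Setoid.refl (X i)
    ; sym   = λ x≈y i → Setoid.sym (X i) (x≈y i)
    ; trans = λ x≈y y≈z i → Setoid.trans (X i) (x≈y i) (y≈z i)
    }
  }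

SelectionFunction : Setoid a ℓ → Setoid r s → (p : Level) →
                    Set (a ⊔ ℓ ⊔ r ⊔ s ⊔ lsuc p)
SelectionFunction X R p = Func (X ⇨ R) (𝒫 X p)

overline : {X : Setoid a ℓ} {R : Setoid r s} →
           SelectionFunction X R p → Func (X ⇨ R) (𝒫 R (a ⊔ s ⊔ p))
overline {X = X} {R = R} ε = record
  { to = λ f → record
    { member   = λ y → ∃[ x ] (x ∈ₛ ε ⟨$⟩ f) × f ⟨$⟩ x ≈ y
    ; respects = λ y≈z (x , x∈ , fx≈y) → x , x∈ , R.trans fx≈y y≈z
    }
  ; cong = λ {f} {g} f≈g →
      (λ (x , x∈ , fx≈y) →
        x , proj₁ (Func.cong ε {f} {g} f≈g) x∈ , R.trans (R.sym (f≈g x)) fx≈y) ,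
      (λ (x , x∈ , gx≈y) →
        x , proj₂ (Func.cong ε {f} {g} f≈g) x∈ , R.trans (f≈g x) gx≈y)
  }
  where
  module R = Setoid R
  open R using (_≈_)

argmax : (i : Fin n) (X : Setoid a ℓ) → SelectionFunction X (ℝ^ n) a
argmax i X = record
  { to = λ f → record
    { member   = λ x → ∀ x′ → (f ⟨$⟩ x) i ≥ᵣ (f ⟨$⟩ x′) i
    ; respects = λ x≈y x-max x′ →
        trans (x-max x′) (reflexive (Func.cong f x≈y i))
    }
  ; cong = λ {f} {g} f≈g →
      (λ {x} x-max x′ → trans (reflexive (Eq.sym (f≈g x′ i)))
                          (trans (x-max x′) (reflexive (f≈g x i)))) ,
      (λ {x} x-max x′ → trans (reflexive (f≈g x′ i))
                          (trans (x-max x′) (reflexive (Eq.sym (f≈g x i)))))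
  }
  where open Poset ℝ-poset using (reflexive; trans; module Eq)

_[_↦_] : {A : Fin n → Set a} → (∀ i → A i) → (i : Fin n) → A i → ∀ j → A j
(x [ i ↦ y ]) j with i ≟ j
... | yes refl = y
... | no  _    = x j

module _ {X : Fin n → Setoid a ℓ} where

  update-cong : ∀ (x : Carrier (∏ X)) i {y z} → Setoid._≈_ (X i) y z →
                Setoid._≈_ (∏ X) (x [ i ↦ y ]) (x [ i ↦ z ])
  update-cong x i y≈z j with i ≟ j
  ... | yes refl = y≈z
  ... | no  _    = Setoid.refl (X j)

  unilateralContext : {R : Setoid r s} → Func (∏ X) R →
                      (i : Fin n) → Carrier (∏ X) → Func (X i) R
  unilateralContext q i x = record
    { to   = λ y → q ⟨$⟩ (x [ i ↦ y ])
    ; cong = λ y≈z → Func.cong q (update-cong x i y≈z)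
    }

record Game (n : ℕ) (X : Fin n → Setoid a ℓ) (R : Setoid r s) (p : Level) :
            Set (a ⊔ ℓ ⊔ r ⊔ s ⊔ lsuc p) where
  field
    ε : ∀ i → SelectionFunction (X i) R p
    q : Func (∏ X) R

module _ {X : Fin n → Setoid a ℓ} {R : Setoid r s} (G : Game n X R p) where
  open Game G

  GeneralisedNashEquilibrium : Carrier (∏ X) → Set (a ⊔ s ⊔ p)
  GeneralisedNashEquilibrium x =
    ∀ i → q ⟨$⟩ x ∈ₛ overline (ε i) ⟨$⟩ unilateralContext q i x

  SelectionEquilibrium : Carrier (∏ X) → Set p
  SelectionEquilibrium x = ∀ i → x i ∈ₛ ε i ⟨$⟩ unilateralContext q i x

module _ (X : Fin n → Setoid a ℓ) (q : Func (∏ X) (ℝ^ n)) where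

  strategicGame : Game n X (ℝ^ n) a
  strategicGame = record { ε = λ i → argmax i (X i) ; q = q }

  NashEquilibrium : Carrier (∏ X) → Set a
  NashEquilibrium x =
    ∀ i (x′ : Carrier (X i)) → (q ⟨$⟩ x) i ≥ᵣ (q ⟨$⟩ (x [ i ↦ x′ ])) i

{-# OPTIONS --safe #-}
module Submission where

-- Replacing the i-th entry of x by x i changes nothing, so player i's
-- unilateral context takes the value q x at x i; and any maximiser y of the
-- context with value q x forces q x to be the maximum, whatever y is.

open import Defs
open import Data.Fin using (Fin)
open import Data.Fin.Properties using (_≟_)
open import Data.Nat using (ℕ; _≥_)
open import Data.Product using (_×_; _,_)
open import Function.Base using (_∘_)
open import Function.Bundles using (Func; _⇔_; _⟨$⟩_; mk⇔)
open import Level using (Level)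
open import Relation.Binary.Bundles using (Setoid; Poset)
open import Relation.Binary.PropositionalEquality using (refl)
open import Relation.Nullary using (yes; no)

private
  variable
    a ℓ r s p : Level
    n : ℕ

-- Equality in `∏ X` is entrywise, so deciding `i ≟ j` lets the update compute at each `j`.
update-self : (X : Fin n → Setoid a ℓ) (x : Setoid.Carrier (∏ X)) (i : Fin n) →
              Setoid._≈_ (∏ X) (x [ i ↦ x i ]) x
update-self X x i j with i ≟ j
... | yes refl = Setoid.refl (X i)
... | no  _    = Setoid.refl (X j)

module _ {X : Fin n → Setoid a ℓ} {R : Setoid r s} where
  open Setoid R using (_≈_)

  unilateralContext-self : (q : Func (∏ X) R) (i : Fin n) (x : Setoid.Carrier (∏ X)) →
                           unilateralContext {X = X} {R = R} q i x ⟨$⟩ x i ≈ q ⟨$⟩ x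
  unilateralContext-self q i x = Func.cong q (update-self X x i)

  -- Works for arbitrary selection functions: the selected move that yields `q ⟨$⟩ x` is `x i`
  -- itself.
  selection⇒generalisedNash : (G : Game n X R p) {x : Setoid.Carrier (∏ X)} →
                              SelectionEquilibrium G x → GeneralisedNashEquilibrium G x
  selection⇒generalisedNash G {x} sel i =
    x i , sel i , unilateralContext-self (Game.q G) i x

module _ (X : Fin n → Setoid a ℓ) (q : Func (∏ X) (ℝ^ n)) {x : Setoid.Carrier (∏ X)} where
  open Poset ℝ-poset using (reflexive; trans; module Eq)

  nash⇒selection : NashEquilibrium X q x → SelectionEquilibrium (strategicGame X q) x
  nash⇒selection nash i x′ =
    -- The values of the context are the outcomes of deviations, which `nash` bounds by the outcome
    -- of `x`; that outcome is the context's value at `x i`.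
    trans (nash i x′) (reflexive (Eq.sym (unilateralContext-self {X = X} {R = ℝ^ _} q i x i)))

  -- This direction is specific to `argmax`: being a maximiser depends only on the value attained,
  -- so the witness `y` may differ from `x i`.
  generalisedNash⇒nash : GeneralisedNashEquilibrium (strategicGame X q) x → NashEquilibrium X q x
  generalisedNash⇒nash gen i x′ with gen i
  ... | y , y-max , qy≈qx = trans (y-max x′) (reflexive (qy≈qx i))

theorem4p11 : {a ℓ : Level} (n : ℕ) → n ≥ 1 →
    (X : Fin n → Setoid a ℓ) (q : Func (∏ X) (ℝ^ n)) (x : Setoid.Carrier (∏ X)) →
    (NashEquilibrium X q x ⇔ GeneralisedNashEquilibrium (strategicGame X q) x)
    × (GeneralisedNashEquilibrium (strategicGame X q) x ⇔ SelectionEquilibrium (strategicGame X q) x)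
theorem4p11 n _ X q x =
  -- The cycle Nash, selection, generalised Nash, Nash gives both equivalences.
  mk⇔ (sel⇒gen ∘ nash⇒sel) gen⇒nash , mk⇔ (nash⇒sel ∘ gen⇒nash) sel⇒gen
  where
  sel⇒gen  = selection⇒generalisedNash (strategicGame X q) {x}
  nash⇒sel = nash⇒selection X q {x}
  gen⇒nash = generalisedNash⇒nash X q {x}
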